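{- Let $m=p^s$ be a prime power with $p$ prime and $s\geq 2$, and let $k=p^{s-1}+1$. Then there exist constants $C_m>0$ and $0< c_m \leq m/2$ (depending only on $m$) such that for all integers $n\ge 1$ $$r_k(\mathbb{Z}_m^n)\geq C_m \frac{(m-p+1)^n}{n^{c_m}}.$$
   Context: $\mathbb{Z}_m^n$ denotes the additive group $(\mathbb{Z}/m\mathbb{Z})^n$. A proper arithmetic progression of length $k$ in $\mathbb{Z}_m^n$ is a sequence $x, x+d, \ldots, x+(k-1)d$ (with $x,d\in\mathbb{Z}_m^n$) whose $k$ elements are pairwise distinct. $r_k(\mathbb{Z}_m^n)$ denotes the maximal size of a set $S\subseteq\mathbb{Z}_m^n$ that does not contain a proper arithmetic progression of length $k$. -}

module Defs where

import Algebra.Definitions.RawSemiring as RawSemiring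
open import Data.Bool.Base using (true; false)
open import Data.Fin.Base using (Fin; zero; suc; toℕ; combine; finToFun; funToFin)
open import Data.Fin.Properties using (_≟_; all?; any?; nonZeroIndex; finToFun-funToFin)
open import Data.Fin.Subset using (Subset; _∈_; ∣_∣; ⊥)
open import Data.Fin.Subset.Properties using (_∈?_; ∉⊥)
import Data.Integer.Base as ℤ
open import Data.List.Base using (List; []; _∷_; _++_; map; filter)
open import Data.List.Extrema.Nat using (max; xs≤max; argmax-sel)
import Data.List.Membership.Propositional as List
open import Data.List.Membership.Propositional.Properties using (∈-map⁺; ∈-map⁻; ∈-++⁺ˡ; ∈-++⁺ʳ; ∈-filter⁺; ∈-filter⁻)
import Data.List.Relation.Unary.All as All
open import Data.List.Relation.Unary.Any using (here)
open import Data.Nat.Base using (ℕ; zero; suc; _+_; _*_; _^_; _≤_; NonZero)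
open import Data.Nat.DivMod using (_mod_)
open import Data.Nat.Properties using (n≤0⇒n≡0)
open import Data.Product.Base using (∃-syntax; _×_; _,_; proj₂)
open import Data.Rational.Base as ℚ using (ℚ; ↥_; ↧ₙ_)
open import Data.Sum.Base using (inj₁; inj₂)
open import Data.Vec.Base as Vec using ()
open import Function.Base using (_∘_; id)
open import Function.Definitions using (Injective)
open import Relation.Binary.PropositionalEquality using (_≡_; _≗_; refl; sym; trans; cong₂; subst)
open import Relation.Nullary using (¬_; Dec; map′; ¬?; _×-dec_; _→-dec_)

-- Elements of (ℤ/mℤ)ⁿ, with Fin m as the residues; equality is pointwise, _≗_.
Point : ℕ → ℕ → Set
Point m n = Fin n → Fin m

-- x + i·d. For m = 0 and n > 0 there are no points, so nonZeroIndex supplies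
-- the nonzero modulus.
term : ∀ {m n} → Point m n → Point m n → ℕ → Point m n
term {m} x d i j = ((toℕ (x j) + i * toℕ (d j)) mod m) {{nonZeroIndex (x j)}}

-- Subsets of (ℤ/mℤ)ⁿ, through the bijection funToFin (base-m digits) between
-- points, up to _≗_, and Fin (m ^ n).
PointSet : ℕ → ℕ → Set
PointSet m n = Subset (m ^ n)

_∈ₚ_ : ∀ {m n} → Point m n → PointSet m n → Set
x ∈ₚ S = funToFin x ∈ S

Proper : ∀ k m n → Point m n → Point m n → Set
Proper k m n x d = Injective {A = Fin k} _≡_ _≗_ (term x d ∘ toℕ)

ContainsProperAP : ∀ k m n → PointSet m n → Set
ContainsProperAP k m n S =
  ∃[ x ] ∃[ d ] Proper k m n x d × (∀ (i : Fin k) → _∈ₚ_ {m} {n} (term x d (toℕ i)) S)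

APFree : ∀ k m n → PointSet m n → Set
APFree k m n S = ¬ ContainsProperAP k m n S

funToFin-cong : ∀ {m n} {f g : Point m n} → f ≗ g → funToFin f ≡ funToFin g
funToFin-cong {n = zero}  f≗g = refl
funToFin-cong {n = suc n} f≗g = cong₂ combine (f≗g zero) (funToFin-cong (f≗g ∘ suc))

term-cong : ∀ {m n} {x x′ d d′ : Point m n} → x ≗ x′ → d ≗ d′ → ∀ i → term x d i ≗ term x′ d′ i
term-cong x≗ d≗ i j rewrite x≗ j | d≗ j = refl

proper? : ∀ k m n (x d : Point m n) → Dec (Proper k m n x d)
proper? k m n x d = map′ (λ f {i} {j} → f i j) (λ f i j → f {i} {j})
  (all? λ i → all? λ j → all? (λ l → term x d (toℕ i) l ≟ term x d (toℕ j) l) →-dec (i ≟ j))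

containsProperAP? : ∀ k m n (S : PointSet m n) → Dec (ContainsProperAP k m n S)
containsProperAP? k m n S = map′
  (λ (a , b , q) → finToFun a , finToFun b , q)
  (λ (x , d , pr , mem) → funToFin x , funToFin d ,
    (λ {i} {j} e → pr (λ l → trans (sym (decode x d (toℕ i) l)) (trans (e l) (decode x d (toℕ j) l)))) ,
    λ i → subst (_∈ S) (sym (funToFin-cong (decode x d (toℕ i)))) (mem i))
  (any? λ a → any? λ b → proper? k m n (finToFun a) (finToFun b)
    ×-dec all? λ i → funToFin {n} {m} (term (finToFun a) (finToFun b) (toℕ i)) ∈? S)
  where
  decode : ∀ (x d : Point m n) i → term (finToFun (funToFin x)) (finToFun (funToFin d)) i ≗ term x d i
  decode x d = term-cong (finToFun-funToFin x) (finToFun-funToFin d)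

apFree? : ∀ k m n (S : PointSet m n) → Dec (APFree k m n S)
apFree? k m n S = ¬? (containsProperAP? k m n S)

subsets : ∀ N → List (Subset N)
subsets zero    = Vec.[] ∷ []
subsets (suc N) = map (true Vec.∷_) (subsets N) ++ map (false Vec.∷_) (subsets N)

r : (k m n : ℕ) → ℕ
r k m n = max 0 (map ∣_∣ (filter (apFree? k m n) (subsets (m ^ n))))

∈-subsets : ∀ {N} (S : Subset N) → S List.∈ subsets N
∈-subsets Vec.[]          = here refl
∈-subsets (true  Vec.∷ S) = ∈-++⁺ˡ (∈-map⁺ _ (∈-subsets S))
∈-subsets (false Vec.∷ S) = ∈-++⁺ʳ (map _ (subsets _)) (∈-map⁺ _ (∈-subsets S))

r-upper : ∀ k m n S → APFree k m n S → ∣ S ∣ ≤ r k m n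
r-upper k m n S free = All.lookup (xs≤max 0 (map ∣_∣ (filter (apFree? k m n) (subsets (m ^ n)))))
  (∈-map⁺ ∣_∣ (∈-filter⁺ (apFree? k m n) (∈-subsets S) free))

-- k ≥ 1 is needed: every set contains the empty progression.
r-attained : ∀ k m n .{{_ : NonZero k}} → ∃[ S ] APFree k m n S × ∣ S ∣ ≡ r k m n
r-attained k@(suc _) m n with argmax-sel id 0 (map ∣_∣ (filter (apFree? k m n) (subsets (m ^ n))))
... | inj₁ r≡0 = ⊥ , ⊥-free ,
  trans (n≤0⇒n≡0 (subst (∣ ⊥ {m ^ n} ∣ ≤_) r≡0 (r-upper k m n ⊥ ⊥-free))) (sym r≡0)
  where
  ⊥-free : APFree k m n ⊥
  ⊥-free (x , d , _ , mem) = ∉⊥ (mem zero)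
... | inj₂ r∈ with ∈-map⁻ ∣_∣ r∈
...   | S , S∈ , eq = S , proj₂ (∈-filter⁻ (apFree? k m n) {xs = subsets (m ^ n)} S∈) , sym eq

open RawSemiring ℚ.+-*-rawSemiring using () renaming (_^_ to _^ℚ_)

fromℕ : ℕ → ℚ
fromℕ n = ℤ.+ n ℚ./ 1

-- N ≥ A / n ^ c for rational A ≥ 0, rational c = a / b ≥ 0 and n ≥ 1: since
-- n ^ (a / b) is the positive b-th root of n ^ a, this is A ^ b ≤ N ^ b * n ^ a.
infix 4 _≥_/[_^_]
_≥_/[_^_] : ℕ → ℚ → ℕ → ℚ → Set
N ≥ A /[ n ^ c ] = A ^ℚ (↧ₙ c) ℚ.≤ fromℕ (N ^ (↧ₙ c) * n ^ ℤ.∣ ↥ c ∣)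

{-# OPTIONS --safe #-}

-- Put q = pˢ⁻¹ and m = p q, let D be the set of digits that are 0 or not divisible
-- by q, and let S be the set of points with all coordinates in D and exactly N
-- coordinates 0. Suppose S contains x, x + d, …, x + q d. If xⱼ = 0 then dⱼ = 0:
-- otherwise some i ≤ q makes i dⱼ a nonzero multiple of q, which is not in D.
-- So the zero coordinates of x are zero in every term, and since their number is
-- always N, no term has any others. If the progression is proper then q d ≠ 0, so
-- some dⱼ is a unit, and the terms x + i d with i < q meet every class modulo q at
-- j, in particular the class of 0; that coordinate is then 0, whence xⱼ = 0 and
-- dⱼ = 0, a contradiction. As ∣D∣ = m − p + 1, one of the n + 1 values of N gives
-- at least (m − p + 1)ⁿ / (n + 1) points.
module Submission where

open import Defs
open import Data.Fin.Base using (Fin; zero; suc; toℕ; fromℕ<; combine; remQuot; finToFun; funToFin)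
open import Data.Fin.Properties using (all?; toℕ<n; toℕ-fromℕ<; toℕ-injective; suc-injective; ¬∀⟶∃¬; combine-injectiveˡ; combine-injectiveʳ; combine-remQuot; toℕ-combine; finToFun-funToFin; funToFin-finToFin)
open import Data.Fin.Subset using (Subset; _∈_; _∪_; _-_; ⋃; ∣_∣; inside; outside)
open import Data.Fin.Subset.Properties using (p⊂q⇒∣p∣<∣q∣; x∈p⇒∣p-x∣<∣p∣; x∈p∧x≢y⇒x∈p-y; x∈p∪q⁺; ∣⊥∣≡0; ∣p∣≤n)
open import Data.Integer.Base using (+_)
import Data.Integer.Base as ℤ
import Data.Integer.Properties as ℤ
open import Data.List.Base using (List; []; _∷_; length; map; upTo)
import Data.List.Membership.Propositional as List
open import Data.List.Membership.Propositional.Properties using (∈-map⁺; ∈-upTo⁺)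
open import Data.List.Properties using (length-map; length-upTo)
open import Data.List.Relation.Unary.All as All using (All; []; _∷_)
import Data.List.Relation.Unary.All.Properties as All
open import Data.List.Relation.Unary.Any using (here; there)
open import Data.Nat.Base using (ℕ; zero; suc; pred; _+_; _*_; _∸_; _^_; _≤_; _<_; z≤n; s≤s; NonZero; >-nonZero⁻¹; nonTrivial⇒n>1)
open import Data.Nat.Coprimality using (Coprime; coprime-divisor; coprime-Bézout)
open import Data.Nat.Divisibility
open import Data.Nat.DivMod using (_%_; m%n<n; m<n⇒m%n≡m; %-distribˡ-+; m*n%n≡0; %-distribˡ-*; [m+kn]%n≡m%n)
open import Data.Nat.GCD using (module Bézout)
open import Data.Nat.Primality using (Prime; prime⇒nonZero; prime⇒irreducible; prime⇒nonTrivial)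
open import Data.Nat.Properties hiding (suc-injective)
open import Data.Nat.Tactic.RingSolver using (solve-∀)
open import Data.Product.Base using (∃-syntax; _×_; _,_; proj₁; proj₂)
open import Data.Rational.Base as ℚ using (0ℚ; 1ℚ; ½; toℚᵘ)
import Data.Rational.Properties as ℚ
open import Data.Rational.Unnormalised.Base as ℚᵘ using (mkℚᵘ; *≤*)
import Data.Rational.Unnormalised.Properties as ℚᵘ
open import Data.Sum.Base using (inj₁; inj₂)
open import Data.Vec.Base using ([]; _∷_; tabulate)
open import Data.Vec.Properties using (lookup∘tabulate; lookup⇒[]=; []=⇒lookup; tabulate-cong)
open import Function.Base using (_∘_)
open import Function.Definitions using (Injective)
open import Relation.Binary.PropositionalEquality using (_≡_; _≗_; refl; sym; trans; cong; cong₂; subst; subst₂; module ≡-Reasoning)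
open import Relation.Nullary using (¬_; Dec; does; yes; no; contradiction; _×-dec_; _→-dec_)
open import Relation.Nullary.Decidable using (dec-true)
open import Relation.Unary using (Pred; Decidable)

-- Divisibility: linear congruences and multiples with prescribed order.

coprime-^ʳ : ∀ {a b} t → Coprime a b → Coprime a (b ^ t)
coprime-^ʳ zero    c (e∣a , e∣1) = ∣1⇒≡1 e∣1
coprime-^ʳ (suc t) c (e∣a , e∣b^) = coprime-^ʳ t c
  (e∣a , coprime-divisor (λ (f∣e , f∣b) → c (∣-trans f∣e e∣a , f∣b)) e∣b^)

prime∤⇒coprime : ∀ {p d} → Prime p → p ∤ d → Coprime d p
prime∤⇒coprime pr p∤d (e∣d , e∣p) with prime⇒irreducible pr e∣p
... | inj₁ e≡1  = e≡1
... | inj₂ refl = contradiction e∣d p∤d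

-- As `d` is invertible modulo `q`, a solution is minus `x` times its inverse; `reduce` brings it
-- below `q`, so that it indexes a term of the progression.
coprime⇒∣x+id : ∀ {d} q .{{_ : NonZero q}} → Coprime d q → ∀ x → ∃[ i ] i < q × q ∣ x + i * d
coprime⇒∣x+id {d} q@(suc q′) c x = reduce (solution (coprime-Bézout c))
  where
  solution : Bézout.Identity 1 d q → ∃[ i ] q ∣ x + i * d
  -- Here `a` is an inverse of `d`, and `q′` represents -1 modulo `q`, which avoids negative
  -- numbers.
  solution (Bézout.+- a b 1+bq≡ad) = x * q′ * a , divides (x + x * q′ * b) (begin
    x + x * q′ * a * d          ≡⟨ cong (λ z → x + z) (*-assoc (x * q′) a d) ⟩
    x + x * q′ * (a * d)        ≡⟨ cong (λ z → x + x * q′ * z) (sym 1+bq≡ad) ⟩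
    x + x * q′ * (1 + b * q)    ≡⟨ identity x q′ b ⟩
    (x + x * q′ * b) * q        ∎)
    where
    open ≡-Reasoning
    identity : ∀ x y b → x + x * y * (1 + b * suc y) ≡ (x + x * y * b) * suc y
    identity = solve-∀
  solution (Bézout.-+ a b 1+ad≡bq) = x * a , divides (x * b) (begin
    x + x * a * d    ≡⟨ identity x a d ⟩
    x * (1 + a * d)  ≡⟨ cong (x *_) 1+ad≡bq ⟩
    x * (b * q)      ≡⟨ sym (*-assoc x b q) ⟩
    x * b * q        ∎)
    where
    open ≡-Reasoning
    identity : ∀ x a d → x + x * a * d ≡ x * (1 + a * d)
    identity = solve-∀

  reduce : ∃[ i ] q ∣ x + i * d → ∃[ i ] i < q × q ∣ x + i * d
  reduce (i , q∣) = i % q , m%n<n i q , m%n≡0⇒n∣m _ q (begin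
    (x + i % q * d) % q            ≡⟨ %-distribˡ-+ x (i % q * d) q ⟩
    (x % q + i % q * d % q) % q    ≡⟨ cong (λ z → (x % q + z) % q) (%-distribˡ-* (i % q) d q) ⟩
    (x % q + (i % q % q) * (d % q) % q) % q
      ≡⟨ cong (λ z → (x % q + z * (d % q) % q) % q) (m<n⇒m%n≡m (m%n<n i q)) ⟩
    (x % q + (i % q) * (d % q) % q) % q
      ≡⟨ cong (λ z → (x % q + z) % q) (sym (%-distribˡ-* i d q)) ⟩
    (x % q + i * d % q) % q        ≡⟨ sym (%-distribˡ-+ x (i * d) q) ⟩
    (x + i * d) % q                ≡⟨ n∣m⇒m%n≡0 _ q q∣ ⟩
    0                              ∎)
    where open ≡-Reasoning

-- If `p` can be divided out of `d` exactly `v` times, then `v ≤ t` and `i = p ^ (t - v)` works. The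
-- recursion divides `d` by `p` and lowers `t` once per factor.
∃-multiple-of-exact-order : ∀ p .{{_ : NonZero p}} t d → p ^ suc t ∤ d →
  ∃[ i ] i ≤ p ^ t × p ^ t ∣ i * d × p ^ suc t ∤ i * d
∃-multiple-of-exact-order p t d p^∤d with p ∣? d
... | no p∤d = p ^ t , ≤-refl , m∣m*n d , λ h →
  p∤d (*-cancelˡ-∣ (p ^ t) {{m^n≢0 p t}} (subst (_∣ p ^ t * d) (*-comm p (p ^ t)) h))
∃-multiple-of-exact-order p zero d p^∤d | yes p∣d =
  contradiction (subst (_∣ d) (sym (*-identityʳ p)) p∣d) p^∤d
∃-multiple-of-exact-order p (suc t) d p^∤d | yes (divides-refl e)
  with i , i≤ , p^∣ , p^∤ ← ∃-multiple-of-exact-order p t e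
         (λ h → p^∤d (subst (p ^ suc (suc t) ∣_) (*-comm p e) (*-monoʳ-∣ p h)))
  = i , ≤-trans i≤ (m≤n*m (p ^ t) p)
  , subst (p ^ suc t ∣_) swap (*-monoʳ-∣ p p^∣)
  , λ h → p^∤ (*-cancelˡ-∣ p (subst (p ^ suc (suc t) ∣_) (sym swap) h))
  where
  swap : p * (i * e) ≡ i * (e * p)
  swap = trans (*-comm p (i * e)) (*-assoc i e p)

-- Counting in finite subsets.

comprehension : ∀ {n ℓ} {P : Pred (Fin n) ℓ} → Decidable P → Subset n
comprehension P? = tabulate (does ∘ P?)

module _ {n ℓ} {P : Pred (Fin n) ℓ} (P? : Decidable P) where

  ∈-comprehension⁺ : ∀ {i} → P i → i ∈ comprehension P?
  ∈-comprehension⁺ {i} Pi = lookup⇒[]= i _ (trans (lookup∘tabulate _ i) (dec-true (P? i) Pi))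

  ∈-comprehension⁻ : ∀ {i} → i ∈ comprehension P? → P i
  ∈-comprehension⁻ {i} i∈ with P? i | trans (sym (lookup∘tabulate (does ∘ P?) i)) ([]=⇒lookup i∈)
  ... | yes Pi | _ = Pi

∣p∪q∣≤∣p∣+∣q∣ : ∀ {n} (p q : Subset n) → ∣ p ∪ q ∣ ≤ ∣ p ∣ + ∣ q ∣
∣p∪q∣≤∣p∣+∣q∣ []            []            = z≤n
∣p∪q∣≤∣p∣+∣q∣ (outside ∷ p) (outside ∷ q) = ∣p∪q∣≤∣p∣+∣q∣ p q
∣p∪q∣≤∣p∣+∣q∣ (outside ∷ p) (inside  ∷ q) =
  ≤-trans (s≤s (∣p∪q∣≤∣p∣+∣q∣ p q)) (≤-reflexive (sym (+-suc ∣ p ∣ ∣ q ∣)))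
∣p∪q∣≤∣p∣+∣q∣ (inside  ∷ p) (outside ∷ q) = s≤s (∣p∪q∣≤∣p∣+∣q∣ p q)
∣p∪q∣≤∣p∣+∣q∣ (inside  ∷ p) (inside  ∷ q) =
  s≤s (≤-trans (∣p∪q∣≤∣p∣+∣q∣ p q) (+-monoʳ-≤ ∣ p ∣ (n≤1+n ∣ q ∣)))

∣⋃∣≤length*bound : ∀ {n b} {ps : List (Subset n)} → All (λ p → ∣ p ∣ ≤ b) ps → ∣ ⋃ ps ∣ ≤ length ps * b
∣⋃∣≤length*bound {n} []               = ≤-reflexive (∣⊥∣≡0 n)
∣⋃∣≤length*bound     (_∷_ {p} ∣p∣≤b h) =
  ≤-trans (∣p∪q∣≤∣p∣+∣q∣ p _) (+-mono-≤ ∣p∣≤b (∣⋃∣≤length*bound h))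

∈-⋃⁺ : ∀ {n} {i : Fin n} {p ps} → p List.∈ ps → i ∈ p → i ∈ ⋃ ps
∈-⋃⁺ (here refl) i∈p = x∈p∪q⁺ (inj₁ i∈p)
∈-⋃⁺ (there p∈)  i∈p = x∈p∪q⁺ (inj₂ (∈-⋃⁺ p∈ i∈p))

-- Induction on `a`: by injectivity the other values avoid `f zero`, so they lie in the smaller set
-- `S - f zero`.
injective⇒≤∣∣ : ∀ {a n} {f : Fin a → Fin n} {S : Subset n} →
  Injective _≡_ _≡_ f → (∀ i → f i ∈ S) → a ≤ ∣ S ∣
injective⇒≤∣∣ {zero}  inj f∈ = z≤n
injective⇒≤∣∣ {suc a} {f = f} {S} inj f∈ = ≤-<-trans
  (injective⇒≤∣∣ {S = S - f zero} (suc-injective ∘ inj)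
    (λ i → x∈p∧x≢y⇒x∈p-y (f∈ (suc i)) (λ e → contradiction (inj {suc i} {zero} e) λ ())))
  (x∈p⇒∣p-x∣<∣p∣ (f∈ zero))

-- The digit set D.

Admissible : ∀ {m} → ℕ → Fin m → Set
Admissible q a = q ∣ toℕ a → toℕ a ≡ 0

-- Besides 0, the digits are `c * q + r` with `c < p` and `0 < r < q`, which gives `p * (q - 1)` of
-- them.
∃-admissible-digits : ∀ p q .{{_ : NonZero p}} .{{_ : NonZero q}} →
  ∃[ e ] Injective _≡_ _≡_ e × (∀ (a : Fin (suc (p * pred q))) → Admissible {p * q} q (e a))
∃-admissible-digits p@(suc p′) (suc q) = e , e-injective , e-admissible
  where
  split : Fin (p * q) → Fin p × Fin q
  split = remQuot {p} q

  e : Fin (suc (p * q)) → Fin (p * suc q)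
  e zero    = zero
  -- In this body `q` is one less than the modulus. The quotient of `a` by `q` is kept and the
  -- remainder raised by 1, so it is never 0 modulo `suc q`.
  e (suc a) = combine (proj₁ (split a)) (suc (proj₂ (split a)))

  e-injective : Injective _≡_ _≡_ e
  e-injective {zero}  {zero}  _  = refl
  -- `zero` is `combine zero zero`, whose remainder is not a successor.
  e-injective {zero}  {suc b} eq = contradiction
    (combine-injectiveʳ (zero {p′}) (zero {q}) (proj₁ (split b)) (suc (proj₂ (split b))) eq) λ ()
  e-injective {suc a} {zero}  eq = contradiction
    (combine-injectiveʳ (proj₁ (split a)) (suc (proj₂ (split a))) (zero {p′}) (zero {q}) eq) λ ()
  e-injective {suc a} {suc b} eq = cong suc (begin
    a                                                ≡⟨ sym (combine-remQuot {p} q a) ⟩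
    combine (proj₁ (split a)) (proj₂ (split a))      ≡⟨ cong₂ combine
      (combine-injectiveˡ (proj₁ (split a)) _ (proj₁ (split b)) _ eq)
      (suc-injective (combine-injectiveʳ (proj₁ (split a)) _ (proj₁ (split b)) _ eq)) ⟩
    combine (proj₁ (split b)) (proj₂ (split b))      ≡⟨ combine-remQuot {p} q b ⟩
    b                                                ∎)
    where open ≡-Reasoning

  e-admissible : ∀ a → Admissible (suc q) (e a)
  e-admissible zero    _  = refl
  e-admissible (suc a) q∣ = contradiction
    (∣m+n∣m⇒∣n (subst (suc q ∣_) (toℕ-combine (proj₁ (split a)) (suc (proj₂ (split a)))) q∣) (m∣m*n _))
    (>⇒∤ (s≤s (toℕ<n (proj₂ (split a)))))

-- Levels: points over D with a fixed number of zero coordinates.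

zeroSet : ∀ {m n} → Point m n → Subset n
zeroSet x = comprehension (λ j → toℕ (x j) ≟ 0)

∣zeroSet∣ : ∀ {m n} → Point m n → ℕ
∣zeroSet∣ x = ∣ zeroSet x ∣

∣zeroSet∣-cong : ∀ {m n} {x y : Point m n} → x ≗ y → ∣zeroSet∣ x ≡ ∣zeroSet∣ y
∣zeroSet∣-cong x≗y = cong ∣_∣ (tabulate-cong (λ j → cong (λ a → does (toℕ a ≟ 0)) (x≗y j)))

InLevel : ∀ {m n} → ℕ → ℕ → Point m n → Set
InLevel q N x = (∀ j → Admissible q (x j)) × ∣zeroSet∣ x ≡ N

inLevel? : ∀ {m n} q N (x : Point m n) → Dec (InLevel q N x)
inLevel? q N x = all? (λ j → (q ∣? toℕ (x j)) →-dec (toℕ (x j) ≟ 0)) ×-dec (∣zeroSet∣ x ≟ N)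

-- Needed because decoding the code of a point returns it only up to `_≗_`.
inLevel-cong : ∀ {m n q N} {x y : Point m n} → x ≗ y → InLevel q N x → InLevel q N y
inLevel-cong {q = q} x≗y (adm , eq) =
  (λ j → subst (Admissible q) (x≗y j) (adm j)) , trans (sym (∣zeroSet∣-cong x≗y)) eq

level : ∀ {m} n → ℕ → ℕ → PointSet m n
level {m} n q N = comprehension {m ^ n} (inLevel? q N ∘ finToFun {m} {n})

∈ₚ-level⁺ : ∀ {m n q N} {x : Point m n} → InLevel q N x → _∈ₚ_ {m} {n} x (level n q N)
∈ₚ-level⁺ {m} {n} {q} {N} {x} h = ∈-comprehension⁺ (inLevel? q N ∘ finToFun {m} {n})
  (inLevel-cong (sym ∘ finToFun-funToFin x) h)

∈ₚ-level⁻ : ∀ {m n q N} {x : Point m n} → _∈ₚ_ {m} {n} x (level n q N) → InLevel q N x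
∈ₚ-level⁻ {m} {n} {q} {N} {x} h = inLevel-cong (finToFun-funToFin x)
  (∈-comprehension⁻ (inLevel? q N ∘ finToFun {m} {n}) h)

-- Levels contain no proper progression.

toℕ-term : ∀ {m n} .{{_ : NonZero m}} (x d : Point m n) i j →
  toℕ (term x d i j) ≡ (toℕ (x j) + i * toℕ (d j)) % m
toℕ-term x d i j = toℕ-fromℕ< _

level-APFree : ∀ {p} t n N → Prime p → APFree (p ^ t + 1) (p ^ suc t) n (level n (p ^ t) N)
level-APFree {p} t n N pr (x , d , proper , mem) = no-unit-step unit-step
  where
  q m : ℕ
  q = p ^ t
  m = p ^ suc t

  instance
    p≢0 : NonZero p
    p≢0 = prime⇒nonZero pr
    q≢0 : NonZero q
    q≢0 = m^n≢0 p t
    m≢0 : NonZero m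
    m≢0 = m^n≢0 p (suc t)

  inLevel : ∀ {i} → i ≤ q → InLevel q N (term x d i)
  inLevel {i} i≤q = subst (λ l → InLevel q N (term x d l)) (toℕ-fromℕ< i<k)
    (∈ₚ-level⁻ (mem (fromℕ< i<k)))
    where
    i<k : i < q + 1
    i<k = subst (i <_) (+-comm 1 q) (s≤s i≤q)

  q∣m : q ∣ m
  q∣m = n∣m*n p

  q∣⇒term≡0 : ∀ {i j} → i ≤ q → q ∣ toℕ (x j) + i * toℕ (d j) → toℕ (term x d i j) ≡ 0
  q∣⇒term≡0 {i} {j} i≤q q∣ = proj₁ (inLevel i≤q) j
    -- Reduction modulo `m` preserves divisibility by `q` because `q ∣ m`.
    (subst (q ∣_) (sym (toℕ-term x d i j)) (%-presˡ-∣ q∣ q∣m))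

  term₀ : term x d 0 ≗ x
  term₀ j = toℕ-injective (trans (toℕ-term x d 0 j)
    (trans (cong (_% m) (+-identityʳ (toℕ (x j)))) (m<n⇒m%n≡m (toℕ<n (x j)))))

  x≡0⇒d≡0 : ∀ {j} → toℕ (x j) ≡ 0 → toℕ (d j) ≡ 0
  x≡0⇒d≡0 {j} xj≡0 with m ∣? toℕ (d j)
  ... | yes m∣d = trans (sym (m<n⇒m%n≡m (toℕ<n (d j)))) (n∣m⇒m%n≡0 _ m m∣d)
  -- Starting from 0, term `i` would be a multiple of `q`, hence the digit 0, although `m` does not
  -- divide `i * toℕ (d j)`.
  ... | no m∤d with i , i≤q , q∣ , m∤ ← ∃-multiple-of-exact-order p t (toℕ (d j)) m∤d =
    contradiction (m%n≡0⇒n∣m _ m (begin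
      i * toℕ (d j) % m                ≡⟨ cong (λ z → (z + i * toℕ (d j)) % m) (sym xj≡0) ⟩
      (toℕ (x j) + i * toℕ (d j)) % m  ≡⟨ sym (toℕ-term x d i j) ⟩
      toℕ (term x d i j)               ≡⟨ q∣⇒term≡0 i≤q (subst (λ z → q ∣ z + i * toℕ (d j)) (sym xj≡0) q∣) ⟩
      0                                ∎)) m∤
    where open ≡-Reasoning

  x≡0⇒term≡0 : ∀ {j} i → toℕ (x j) ≡ 0 → toℕ (term x d i j) ≡ 0
  x≡0⇒term≡0 {j} i xj≡0 = begin
    toℕ (term x d i j)               ≡⟨ toℕ-term x d i j ⟩
    (toℕ (x j) + i * toℕ (d j)) % m  ≡⟨ cong₂ (λ a b → (a + i * b) % m) xj≡0 (x≡0⇒d≡0 xj≡0) ⟩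
    (i * 0) % m                      ≡⟨ cong (_% m) (*-zeroʳ i) ⟩
    0 % m                            ≡⟨ m*n%n≡0 0 m ⟩
    0                                ∎
    where open ≡-Reasoning

  -- A new zero at `j` would make the zero set of `x` a proper subset of that of term `i`, yet both
  -- have `N` elements.
  term≡0⇒x≡0 : ∀ {i j} → i ≤ q → toℕ (term x d i j) ≡ 0 → toℕ (x j) ≡ 0
  term≡0⇒x≡0 {i} {j} i≤q tj≡0 with toℕ (x j) ≟ 0
  ... | yes xj≡0 = xj≡0
  ... | no  xj≢0 = contradiction equal (<⇒≢ (p⊂q⇒∣p∣<∣q∣
    ( (λ l∈ → ∈-comprehension⁺ Zᵢ? (x≡0⇒term≡0 i (∈-comprehension⁻ Z₀? l∈)))
    , j , ∈-comprehension⁺ Zᵢ? tj≡0 , xj≢0 ∘ ∈-comprehension⁻ Z₀?)))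
    where
    Z₀? : Decidable (λ l → toℕ (x l) ≡ 0)
    Z₀? l = toℕ (x l) ≟ 0
    Zᵢ? : Decidable (λ l → toℕ (term x d i l) ≡ 0)
    Zᵢ? l = toℕ (term x d i l) ≟ 0
    equal : ∣zeroSet∣ x ≡ ∣zeroSet∣ (term x d i)
    equal = trans (sym (∣zeroSet∣-cong term₀))
      (trans (proj₂ (inLevel z≤n)) (sym (proj₂ (inLevel i≤q))))

  -- If `p` divided every coordinate of `d`, then `m = p * q` would divide those of `q * d`, and
  -- terms 0 and `q` would coincide.
  unit-step : ∃[ j ] p ∤ toℕ (d j)
  unit-step = ¬∀⟶∃¬ n (λ j → p ∣ toℕ (d j)) (λ j → p ∣? toℕ (d j)) λ p∣d →
    contradiction
      (trans (sym (toℕ-fromℕ< 0<k)) (trans (cong toℕ (proper (coincide p∣d))) (toℕ-fromℕ< q<k)))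
      (<⇒≢ (>-nonZero⁻¹ q))
    where
    q<k : q < q + 1
    q<k = m<m+n q (s≤s z≤n)
    0<k : 0 < q + 1
    0<k = ≤-<-trans z≤n q<k
    coincide : (∀ j → p ∣ toℕ (d j)) → term x d (toℕ (fromℕ< 0<k)) ≗ term x d (toℕ (fromℕ< q<k))
    coincide p∣d j rewrite toℕ-fromℕ< 0<k | toℕ-fromℕ< q<k with divides e d≡ep ← p∣d j =
      toℕ-injective (begin
        toℕ (term x d 0 j)               ≡⟨ cong toℕ (term₀ j) ⟩
        toℕ (x j)                        ≡⟨ sym (m<n⇒m%n≡m (toℕ<n (x j))) ⟩
        toℕ (x j) % m                    ≡⟨ sym ([m+kn]%n≡m%n (toℕ (x j)) e m) ⟩
        (toℕ (x j) + e * m) % m          ≡⟨ cong (λ z → (toℕ (x j) + z) % m) (sym (trans (cong (q *_) d≡ep) (identity q e p))) ⟩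
        (toℕ (x j) + q * toℕ (d j)) % m  ≡⟨ sym (toℕ-term x d q j) ⟩
        toℕ (term x d q j)               ∎)
      where
      open ≡-Reasoning
      identity : ∀ q e p → q * (e * p) ≡ e * (p * q)
      identity = solve-∀

  no-unit-step : ¬ (∃[ j ] p ∤ toℕ (d j))
  no-unit-step (j , p∤d)
    with i , i<q , q∣ ← coprime⇒∣x+id q (coprime-^ʳ t (prime∤⇒coprime pr p∤d)) (toℕ (x j))
    = p∤d (subst (p ∣_) (sym (x≡0⇒d≡0 (term≡0⇒x≡0 (<⇒≤ i<q) (q∣⇒term≡0 (<⇒≤ i<q) q∣)))) (p ∣0))

-- Union bound over the `n + 1` levels.

admissible^n≤levels*r : ∀ {a m} k n q (e : Fin a → Fin m) → Injective _≡_ _≡_ e →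
  (∀ b → Admissible q (e b)) → (∀ N → APFree k m n (level n q N)) → a ^ n ≤ suc n * r k m n
admissible^n≤levels*r {a} {m} k n q e e-inj e-adm free = begin
  a ^ n                        ≤⟨ injective⇒≤∣∣ embed-injective embed∈ ⟩
  ∣ ⋃ levels ∣                 ≤⟨ ∣⋃∣≤length*bound levels≤r ⟩
  length levels * r k m n      ≡⟨ cong (_* r k m n) (trans (length-map (level n q) (upTo (suc n))) (length-upTo (suc n))) ⟩
  suc n * r k m n              ∎
  where
  open ≤-Reasoning
  levels : List (PointSet m n)
  levels = map (level n q) (upTo (suc n))

  levels≤r : All (λ S → ∣ S ∣ ≤ r k m n) levels
  levels≤r = All.map⁺ {f = level n q}
    (All.universal (λ N → r-upper k m n (level n q N) (free N)) (upTo (suc n)))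

  point : Fin (a ^ n) → Point m n
  point v = e ∘ finToFun {a} {n} v

  embed : Fin (a ^ n) → Fin (m ^ n)
  embed v = funToFin (point v)

  embed-injective : Injective _≡_ _≡_ embed
  embed-injective {v} {w} eq = trans (sym (funToFin-finToFin {n} {a} v))
    (trans (funToFin-cong {a} {n} (λ j → e-inj (trans (sym (finToFun-funToFin (point v) j))
      (trans (cong (λ u → finToFun {m} {n} u j) eq) (finToFun-funToFin (point w) j)))))
    (funToFin-finToFin {n} {a} w))

  embed∈ : ∀ v → embed v ∈ ⋃ levels
  embed∈ v = ∈-⋃⁺ (∈-map⁺ (level n q) (∈-upTo⁺ (s≤s (∣p∣≤n (zeroSet (point v))))))
    (∈ₚ-level⁺ {m} {n} {q} {x = point v} ((λ j → e-adm _) , refl))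

-- Passage to rational constants and conclusion.

toℚᵘ-fromℕ : ∀ a → toℚᵘ (Defs.fromℕ a) ℚᵘ.≃ mkℚᵘ (+ a) 0
toℚᵘ-fromℕ a = ℚ.toℚᵘ-fromℚᵘ (mkℚᵘ (+ a) 0)

-- Unnormalised rationals are used because there the order is plain cross-multiplication.
½*fromℕ≤fromℕ : ∀ {a b} → a ≤ 2 * b → ½ ℚ.* fromℕ a ℚ.≤ fromℕ b
½*fromℕ≤fromℕ {a} {b} a≤2b = ℚ.toℚᵘ-cancel-≤ (begin
  toℚᵘ (½ ℚ.* fromℕ a)          ≃⟨ ℚ.toℚᵘ-homo-* ½ (fromℕ a) ⟩
  toℚᵘ ½ ℚᵘ.* toℚᵘ (fromℕ a)    ≃⟨ ℚᵘ.*-congˡ {toℚᵘ ½} (toℚᵘ-fromℕ a) ⟩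
  toℚᵘ ½ ℚᵘ.* mkℚᵘ (+ a) 0      ≤⟨ *≤* (subst₂ ℤ._≤_ lhs (ℤ.pos-* b 2) (ℤ.+≤+ (subst (a ≤_) (*-comm 2 b) a≤2b))) ⟩
  mkℚᵘ (+ b) 0                  ≃⟨ ℚᵘ.≃-sym (toℚᵘ-fromℕ b) ⟩
  toℚᵘ (fromℕ b)                ∎)
  where
  open ℚᵘ.≤-Reasoning
  lhs : + a ≡ (+ 1 ℤ.* + a) ℤ.* + 1
  lhs = sym (trans (ℤ.*-identityʳ (+ 1 ℤ.* + a)) (ℤ.*-identityˡ (+ a)))

1≤m/2 : ∀ {m} → 2 ≤ m → 1ℚ ℚ.≤ + m ℚ./ 2
1≤m/2 {m} 2≤m = ℚ.toℚᵘ-cancel-≤ (begin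
  toℚᵘ 1ℚ            ≤⟨ *≤* (subst (+ 2 ℤ.≤_) (sym (ℤ.*-identityʳ (+ m))) (ℤ.+≤+ 2≤m)) ⟩
  mkℚᵘ (+ m) 1       ≃⟨ ℚᵘ.≃-sym (ℚ.toℚᵘ-fromℚᵘ (mkℚᵘ (+ m) 1)) ⟩
  toℚᵘ (+ m ℚ./ 2)   ∎)
  where open ℚᵘ.≤-Reasoning

theorem3p13 : ∀ (p s m k : ℕ) → Prime p → 2 ≤ s → m ≡ p ^ s → k ≡ p ^ (s ∸ 1) + 1 →
    ∃[ C ] ∃[ c ] (0ℚ ℚ.< C) × (0ℚ ℚ.< c) × (c ℚ.≤ (+ m ℚ./ 2)) ×
    (∀ (n : ℕ) → 1 ≤ n → r k m n ≥ C ℚ.* fromℕ ((m ∸ p + 1) ^ n) /[ n ^ c ])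
theorem3p13 p (suc t) m k pr 2≤s refl refl =
  -- The loss is only the factor `n + 1 ≤ 2 * n`, so `C = 1/2` and `c = 1` suffice.
  ½ , 1ℚ , ℚ.positive⁻¹ ½ , ℚ.positive⁻¹ 1ℚ , 1≤m/2 2≤m , bound
  where
  q : ℕ
  q = p ^ t

  instance
    p≢0 : NonZero p
    p≢0 = prime⇒nonZero pr
    q≢0 : NonZero q
    q≢0 = m^n≢0 p t

  2≤m : 2 ≤ p * q
  2≤m = ≤-trans (nonTrivial⇒n>1 p {{prime⇒nonTrivial pr}}) (m≤m*n p q)

  digits : p * q ∸ p + 1 ≡ suc (p * pred q)
  digits = begin
    p * q ∸ p + 1                 ≡⟨ +-comm (p * q ∸ p) 1 ⟩
    suc (p * q ∸ p)               ≡⟨ cong (λ z → suc (p * z ∸ p)) (sym (suc-pred q)) ⟩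
    suc (p * suc (pred q) ∸ p)    ≡⟨ cong (λ z → suc (z ∸ p)) (*-suc p (pred q)) ⟩
    suc (p + p * pred q ∸ p)      ≡⟨ cong suc (m+n∸m≡n p (p * pred q)) ⟩
    suc (p * pred q)              ∎
    where open ≡-Reasoning

  -- The exponents 1 are the denominator and numerator of `c = 1` in `_≥_/[_^_]`.
  count : ∀ n → 1 ≤ n → (p * q ∸ p + 1) ^ n ≤ 2 * (r (q + 1) (p * q) n ^ 1 * n ^ 1)
  count n 1≤n with e , e-inj , e-adm ← ∃-admissible-digits p q = begin
    (p * q ∸ p + 1) ^ n      ≡⟨ cong (_^ n) digits ⟩
    suc (p * pred q) ^ n     ≤⟨ admissible^n≤levels*r (q + 1) n q e e-inj e-adm (λ N → level-APFree t n N pr) ⟩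
    suc n * R                ≤⟨ *-monoˡ-≤ R (+-monoˡ-≤ n 1≤n) ⟩
    (n + n) * R              ≡⟨ identity n R ⟩
    2 * (R ^ 1 * n ^ 1)      ∎
    where
    open ≤-Reasoning
    R : ℕ
    R = r (q + 1) (p * q) n
    identity : ∀ n R → (n + n) * R ≡ 2 * ((R * 1) * (n * 1))
    identity = solve-∀

  bound : ∀ n → 1 ≤ n →
    r (q + 1) (p * q) n ≥ ½ ℚ.* fromℕ ((p * q ∸ p + 1) ^ n) /[ n ^ 1ℚ ]
  -- The power `_^ℚ 1` unfolds to a product with 1, removed here.
  bound n 1≤n = subst (ℚ._≤ fromℕ (r (q + 1) (p * q) n ^ 1 * n ^ 1)) (sym (ℚ.*-identityʳ _))
    (½*fromℕ≤fromℕ {b = r (q + 1) (p * q) n ^ 1 * n ^ 1} (count n 1≤n))
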